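{- For every integer $n \geq 1$, the number of $\underline{32}1$-avoiding permutations of $[n+1]$ with maximum inversion number (among all $\underline{32}1$-avoiding permutations of $[n+1]$) is $$|\mathcal{Z}_{n+1}(\underline{32}1)| = \binom{\rho_n}{\lambda_n}+\binom{\rho_n+1}{\lambda_n-1},$$ where $$\rho_n = \left\lfloor \frac{ -3 + \sqrt{8n+17}}{2} \right\rfloor \qquad\text{and}\qquad \lambda_n = n + 2 - T_{\rho_n+1},$$ and $T_i = \binom{i+1}{2} = \sum_{j=1}^i j$ is the $i$th triangular number. These permutations have inversion number $$\operatorname{maxinv} \mathcal{S}_{n+1}(\underline{32}1)=T_{n-\rho_n} + \sum_{i=1}^{\rho_n} T_i = \binom{n-\rho_n +1}{2} + \binom{\rho_n + 2}{3}.$$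
   Context: $\mathcal{S}_N$ is the set of permutations $\pi=\pi_1\pi_2\cdots\pi_N$ of $[N]=\{1,\dots,N\}$. A permutation $\pi \in \mathcal{S}_N$ is $\underline{32}1$-avoiding when there do not exist $1 \leq i < i+1 < j \leq N$ with $\pi_i > \pi_{i+1} > \pi_j$; the set of such permutations is $\mathcal{S}_N(\underline{32}1)$. The inversion number is $\operatorname{inv}(\pi) = |\{(i,j) : i<j \text{ and } \pi_i>\pi_j\}|$. $\operatorname{maxinv}\mathcal{S}_N(\underline{32}1)$ is the maximum of $\operatorname{inv}(\pi)$ over $\pi \in \mathcal{S}_N(\underline{32}1)$, and $\mathcal{Z}_N(\underline{32}1)$ is the set of $\pi\in\mathcal{S}_N(\underline{32}1)$ achieving this maximum. Convention: $\binom{a}{b}=0$ if $b<0$ or $b>a$ (for integers $a\ge 0$). -}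

module Defs where

open import Data.Fin.Base as Fin using (Fin; toℕ)
import Data.Fin.Properties as Fin
open import Data.Fin.Permutation using (Permutation′; _⟨$⟩ʳ_; _≈_)
open import Data.Integer.Base as ℤ using (ℤ; -[1+_])
open import Data.List.Base
  using (allFin; cartesianProduct; filter; length; applyUpTo; [_]; _∷ʳ_)
open import Data.List.Properties using (applyUpTo-∷ʳ)
open import Data.Nat.Base
open import Data.Nat.Combinatorics using (_C_; nC1≡n; nCk+nC[k+1]≡[n+1]C[k+1])
open import Data.Nat.DivMod using (m/n*n≤m; m≡m%n+[m/n]*n; m%n<n)
open import Data.Nat.ListAction using (sum)
open import Data.Nat.ListAction.Properties using (sum-++)
open import Data.Nat.Properties
open import Data.Nat.Tactic.RingSolver using (solve-∀)
open import Data.Product.Base using (∃-syntax; _×_; _,_; proj₁; proj₂)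
open import Function.Bundles using (Inverse)
open import Level using (0ℓ)
open import Relation.Binary.Bundles using (Setoid)
open import Relation.Binary.PropositionalEquality
  using (_≡_; refl; sym; trans; cong; subst; setoid; module ≡-Reasoning)
open import Relation.Nullary using (¬_; yes; no)
open import Relation.Nullary.Decidable using (_×-dec_)

-- Positions and values are numbered 0 , … , N - 1 instead of 1 , … , N.
-- In 32-1 only the first two entries must be adjacent: i⁺ stands for i + 1.
Avoids-32-1 : ∀ {N} → Permutation′ N → Set
Avoids-32-1 {N} π = ¬ (∃[ i ] ∃[ i⁺ ] ∃[ j ]
    toℕ i⁺ ≡ suc (toℕ i) × i⁺ Fin.< j
  × π ⟨$⟩ʳ i Fin.> π ⟨$⟩ʳ i⁺ × π ⟨$⟩ʳ i⁺ Fin.> π ⟨$⟩ʳ j)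

inv : ∀ {N} → Permutation′ N → ℕ
inv {N} π = length (filter
  (λ (i , j) → (i Fin.<? j) ×-dec (π ⟨$⟩ʳ j Fin.<? π ⟨$⟩ʳ i))
  (cartesianProduct (allFin N) (allFin N)))

IsMaxinv : ℕ → ℕ → Set
IsMaxinv N m =
    (∃[ π ] Avoids-32-1 {N} π × inv π ≡ m)
  × (∀ (π : Permutation′ N) → Avoids-32-1 π → inv π ≤ m)

-- A setoid, because without function extensionality a permutation is
-- determined by its values only up to pointwise equality.
𝒵 : ℕ → Setoid 0ℓ 0ℓ
𝒵 N = record
  { Carrier       = ∃[ π ] Avoids-32-1 {N} π × IsMaxinv N (inv π)
  ; _≈_           = λ z w → proj₁ z ≈ proj₁ w
  ; isEquivalence = record
    { refl  = λ _ → refl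
    ; sym   = λ p i → sym (p i)
    ; trans = λ p q i → trans (p i) (q i)
    }
  }

HasCardinality : Setoid 0ℓ 0ℓ → ℕ → Set
HasCardinality S k = Inverse S (setoid (Fin k))

-- Binomial coefficient with an integer lower index; _C_ already vanishes
-- when the lower index exceeds the upper one.
binom : ℕ → ℤ → ℕ
binom a (ℤ.+ k)  = a C k
binom a -[1+ _ ] = 0

T : ℕ → ℕ
T i = suc i C 2

∑T : ℕ → ℕ
∑T r = sum (applyUpTo (λ i → T (suc i)) r)

⌊√_⌋ : ℕ → ℕ
⌊√ zero ⌋ = 0
⌊√ suc k ⌋ with suc ⌊√ k ⌋ * suc ⌊√ k ⌋ ≤? suc k
... | yes _ = suc ⌊√ k ⌋
... | no  _ = ⌊√ k ⌋

-- ⌊(-3 + √(8n+17)) / 2⌋, using ⌊x / 2⌋ = ⌊⌊x⌋ / 2⌋.  The subtraction never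
-- truncates since √17 ≥ 3; the lemmas ρ-lower and ρ-upper below state
-- ρ n ≤ (-3 + √(8n+17)) / 2 < ρ n + 1 with the root cleared.
ρ : ℕ → ℕ
ρ n = (⌊√ 8 * n + 17 ⌋ ∸ 3) / 2

λₙ : ℕ → ℤ
λₙ n = ℤ.+ (n + 2) ℤ.- ℤ.+ T (suc (ρ n))

⌊√⌋-lower : ∀ k → ⌊√ k ⌋ * ⌊√ k ⌋ ≤ k
⌊√⌋-lower zero = z≤n
⌊√⌋-lower (suc k) with suc ⌊√ k ⌋ * suc ⌊√ k ⌋ ≤? suc k
... | yes p = p
... | no  _ = m≤n⇒m≤1+n (⌊√⌋-lower k)

⌊√⌋-upper : ∀ k → k < suc ⌊√ k ⌋ * suc ⌊√ k ⌋
⌊√⌋-upper zero = s≤s z≤n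
⌊√⌋-upper (suc k) with suc ⌊√ k ⌋ * suc ⌊√ k ⌋ ≤? suc k
... | yes p = ≤-<-trans (⌊√⌋-upper k)
                (*-mono-< (n<1+n (suc ⌊√ k ⌋)) (n<1+n (suc ⌊√ k ⌋)))
... | no ¬p = ≰⇒> ¬p

private
  3≤√ : ∀ n → 3 ≤ ⌊√ 8 * n + 17 ⌋
  3≤√ n = ≮⇒≥ λ r<3 → <⇒≱ (⌊√⌋-upper (8 * n + 17))
    (≤-trans (*-mono-≤ r<3 r<3)
      (≤-trans (m≤m+n 9 8) (m≤n+m 17 (8 * n))))

ρ-lower : ∀ n → (3 + 2 * ρ n) * (3 + 2 * ρ n) ≤ 8 * n + 17
ρ-lower n = ≤-trans (*-mono-≤ step step) (⌊√⌋-lower (8 * n + 17))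
  where
  r = ⌊√ 8 * n + 17 ⌋
  step : 3 + 2 * ρ n ≤ r
  step = begin
    3 + 2 * ρ n    ≡⟨ cong (3 +_) (*-comm 2 (ρ n)) ⟩
    3 + ρ n * 2    ≤⟨ +-monoʳ-≤ 3 (m/n*n≤m (r ∸ 3) 2) ⟩
    3 + (r ∸ 3)    ≡⟨ m+[n∸m]≡n (3≤√ n) ⟩
    r              ∎
    where open ≤-Reasoning

ρ-upper : ∀ n → 8 * n + 17 < (3 + 2 * suc (ρ n)) * (3 + 2 * suc (ρ n))
ρ-upper n = <-≤-trans (⌊√⌋-upper (8 * n + 17)) (*-mono-≤ step step)
  where
  r = ⌊√ 8 * n + 17 ⌋
  below : r ∸ 3 < suc (ρ n) * 2
  below = subst (_< suc (ρ n) * 2) (sym (m≡m%n+[m/n]*n (r ∸ 3) 2))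
            (+-monoˡ-< (ρ n * 2) (m%n<n (r ∸ 3) 2))
  step : suc r ≤ 3 + 2 * suc (ρ n)
  step = begin
    suc r              ≡⟨ cong suc (m+[n∸m]≡n (3≤√ n)) ⟨
    suc (3 + (r ∸ 3))  ≡⟨ +-suc 3 (r ∸ 3) ⟨
    3 + suc (r ∸ 3)    ≤⟨ +-monoʳ-≤ 3 below ⟩
    3 + suc (ρ n) * 2  ≡⟨ cong (3 +_) (*-comm (suc (ρ n)) 2) ⟩
    3 + 2 * suc (ρ n)  ∎
    where open ≤-Reasoning

-- Hence n ∸ ρ n is the true difference.
ρ≤n : ∀ n → ρ n ≤ n
ρ≤n n = ≮⇒≥ λ n<ρ → <⇒≱ big (≤-trans
    (let q = +-monoʳ-≤ 3 (*-monoʳ-≤ 2 n<ρ) in *-mono-≤ q q) (ρ-lower n))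
  where
  expand : ∀ m → (3 + 2 * suc m) * (3 + 2 * suc m)
                 ≡ suc (8 * m + 17) + (4 * m * m + 12 * m + 7)
  expand = solve-∀
  big : 8 * n + 17 < (3 + 2 * suc n) * (3 + 2 * suc n)
  big = subst (8 * n + 17 <_) (sym (expand n)) (m≤m+n _ _)

T≡∑ : ∀ i → T i ≡ sum (applyUpTo suc i)
T≡∑ zero    = refl
T≡∑ (suc i) = begin
  suc (suc i) C 2                        ≡⟨ nCk+nC[k+1]≡[n+1]C[k+1] (suc i) 1 ⟨
  suc i C 1 + T i                        ≡⟨ cong (_+ T i) (nC1≡n (suc i)) ⟩
  suc i + T i                            ≡⟨ +-comm (suc i) (T i) ⟩
  T i + suc i                            ≡⟨ cong (_+ suc i) (T≡∑ i) ⟩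
  sum (applyUpTo suc i) + suc i          ≡⟨ cong (sum (applyUpTo suc i) +_) (+-identityʳ (suc i)) ⟨
  sum (applyUpTo suc i) + sum [ suc i ]  ≡⟨ sum-++ (applyUpTo suc i) [ suc i ] ⟨
  sum (applyUpTo suc i ∷ʳ suc i)         ≡⟨ cong sum (applyUpTo-∷ʳ suc i) ⟩
  sum (applyUpTo suc (suc i))            ∎
  where open ≡-Reasoning

{-# OPTIONS --safe #-}

-- Replace π by its Lehmer code c, where c i counts the later entries below
-- π i.  Then inv π = Σ c, and π avoids 32-1 exactly when every entry of c is 0
-- or at least its predecessor.  Such a code splits into blocks, each a
-- weakly increasing run followed by a 0; if b entries follow a block with p
-- entries before its 0, these p entries are at most b + 1.
--
-- For every r put U r N = (N - r)(N - r - 1) / 2 + T 1 + ⋯ + T r.  The identity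
--   U (1 + r) (p + 1 + b) = p (b + 1) + U r b + k (k - 1) / 2,  k = p - (1 + r),
-- yields Σ c ≤ U r N for every r at once, by induction on r, and shows that
-- equality forces p ∈ {r + 1 , r + 2} together with equality for the remaining
-- b entries, down to r = 0, where equality forces N ≤ 2.  The choice of p
-- produces Pascal's rule.  For r = ρ the bound is attained.
module Submission where

open import Defs
open import Data.Bool.Base using (if_then_else_; true; false)
open import Data.Fin.Base as Fin using (Fin; zero; suc; toℕ; fromℕ<; punchIn)
import Data.Fin.Properties as Fin
open import Data.Fin.Permutation
  using (Permutation′; _⟨$⟩ʳ_; _⟨$⟩ˡ_; _≈_; remove; insert; punchIn-permute; remove-insert;
         inverseʳ)
  renaming (id to idₚ)
open import Data.Integer.Base as ℤ using (ℤ; +_; -[1+_]; 0ℤ; 1ℤ)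
import Data.Integer.Properties as ℤ
import Data.Integer.Tactic.RingSolver as ℤ-Solver
open import Data.List.Base as List
  using (List; []; _∷_; [_]; _∷ʳ_; _++_; length; filter; tabulate; map;
         cartesianProduct; replicate; applyUpTo)
open import Data.List.Properties
  using (length-++; length-map; filter-++; map-tabulate; ∷-injective; applyUpTo-∷ʳ)
open import Data.List.Membership.Propositional using (_∈_)
open import Data.List.Membership.Propositional.Properties
  using (∈-lookup; ∈-map⁺; ∈-map⁻; ∈-++⁺ˡ; ∈-++⁺ʳ; ∈-++⁻)
open import Data.List.Relation.Unary.All as All using ([])
open import Data.List.Relation.Unary.AllPairs using ([]; _∷_)
open import Data.List.Relation.Unary.Any using (index; here)
open import Data.List.Relation.Unary.Any.Properties using (lookup-index)
open import Data.List.Relation.Unary.Unique.Propositional using (Unique)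
import Data.List.Relation.Unary.Unique.Propositional.Properties as Unique
open import Data.Nat.Base
open import Data.Nat.Combinatorics
  using (_C_; nCk≡nC[n∸k]; nCn≡1; nC1≡n; nCk+nC[k+1]≡[n+1]C[k+1]; k>n⇒nCk≡0)
open import Data.Nat.ListAction using (sum)
open import Data.Nat.ListAction.Properties using (sum-++)
open import Data.Nat.Properties
import Data.Nat.Tactic.RingSolver as ℕ-Solver
open import Data.Product.Base using (_×_; _,_; proj₁; proj₂; ∃-syntax; Σ-syntax)
open import Data.Sum.Base using (_⊎_; inj₁; inj₂)
open import Data.Unit.Base using (⊤; tt)
open import Function.Base using (_∘_)
open import Function.Bundles using (_⇔_; mk⇔; Equivalence)
open import Level using (0ℓ)
open import Relation.Binary.Bundles using (Setoid)
open import Relation.Binary.PropositionalEquality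
  using (_≡_; refl; sym; trans; cong; cong₂; subst; subst₂; module ≡-Reasoning)
open import Relation.Nullary using (¬_; Dec; does; contradiction; yes; no)
open import Relation.Nullary.Decidable using (_×-dec_; does-⇔)
open import Relation.Unary using (Decidable)
import Algebra.Properties.CommutativeMonoid.Sum +-0-commutativeMonoid as ∑

open Equivalence using (to; from)

private
  variable
    n : ℕ

-- Inversions and Lehmer codes

𝟙 : ∀ {A : Set} → Dec A → ℕ
𝟙 a? = if does a? then 1 else 0

𝟙-⇔ : ∀ {A B : Set} → A ⇔ B → (a? : Dec A) (b? : Dec B) → 𝟙 a? ≡ 𝟙 b?
𝟙-⇔ A⇔B a? b? = cong (if_then 1 else 0) (does-⇔ A⇔B a? b?)

module _ {A : Set} {P : A → Set} (P? : Decidable P) where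

  length-filter-tabulate : (f : Fin n → A) →
    length (filter P? (tabulate f)) ≡ ∑.sum λ i → 𝟙 (P? (f i))
  length-filter-tabulate {zero}  f = refl
  length-filter-tabulate {suc n} f
    with ih ← length-filter-tabulate (f ∘ suc) | does (P? (f zero))
  ... | true  = cong suc ih
  ... | false = ih

length-filter-cartesianProduct : ∀ {A B : Set} {P : A × B → Set} (P? : Decidable P)
  {m n} (f : Fin m → A) (g : Fin n → B) →
  length (filter P? (cartesianProduct (tabulate f) (tabulate g)))
    ≡ ∑.sum λ i → ∑.sum λ j → 𝟙 (P? (f i , g j))
length-filter-cartesianProduct P? {zero}  f g = refl
length-filter-cartesianProduct P? {suc m} f g = begin
  length (filter P? (row ++ rest))
    ≡⟨ cong length (filter-++ P? row rest) ⟩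
  length (filter P? row ++ filter P? rest)
    ≡⟨ length-++ (filter P? row) ⟩
  length (filter P? row) + length (filter P? rest)
    ≡⟨ cong₂ (λ r s → length (filter P? r) + s) (map-tabulate g (f zero ,_))
         (length-filter-cartesianProduct P? (f ∘ suc) g) ⟩
  length (filter P? (tabulate (λ j → f zero , g j))) + _
    ≡⟨ cong (_+ _) (length-filter-tabulate P? (λ j → f zero , g j)) ⟩
  _ ∎
  where
  open ≡-Reasoning
  row  = map (f zero ,_) (tabulate g)
  rest = cartesianProduct (tabulate (f ∘ suc)) (tabulate g)

inv≡∑∑ : (π : Permutation′ n) → inv π ≡
  ∑.sum λ i → ∑.sum λ j → 𝟙 ((i Fin.<? j) ×-dec (π ⟨$⟩ʳ j Fin.<? π ⟨$⟩ʳ i))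
inv≡∑∑ {n} π = length-filter-cartesianProduct
  (λ (i , j) → (i Fin.<? j) ×-dec (π ⟨$⟩ʳ j Fin.<? π ⟨$⟩ʳ i)) {n} (λ i → i) (λ j → j)

∑-𝟙-< : ∀ n {k} → k ≤ n → (∑.sum λ (j : Fin n) → 𝟙 (toℕ j <? k)) ≡ k
∑-𝟙-< zero    z≤n       = refl
∑-𝟙-< (suc n) z≤n       = ∑-𝟙-< n z≤n
∑-𝟙-< (suc n) (s≤s k≤n) = cong suc (∑-𝟙-< n k≤n)

punchIn-<-pivot : ∀ (i : Fin (suc n)) j → punchIn i j Fin.< i ⇔ toℕ j < toℕ i
punchIn-<-pivot i j = mk⇔ (fwd i j) (bwd i j)
  where
  fwd : ∀ {n} (i : Fin (suc n)) j → punchIn i j Fin.< i → toℕ j < toℕ i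
  fwd (suc i) zero    _       = z<s
  fwd (suc i) (suc j) (s≤s p) = s≤s (fwd i j p)
  bwd : ∀ {n} (i : Fin (suc n)) j → toℕ j < toℕ i → punchIn i j Fin.< i
  bwd (suc i) zero    _       = z<s
  bwd (suc i) (suc j) (s≤s p) = s≤s (bwd i j p)

punchIn-< : ∀ (i : Fin (suc n)) j k → punchIn i j Fin.< punchIn i k ⇔ j Fin.< k
punchIn-< i j k = mk⇔
  (λ p → ≰⇒> (<⇒≱ p ∘ Fin.punchIn-mono-≤ i k j))
  (λ p → ≰⇒> (<⇒≱ p ∘ Fin.punchIn-cancel-≤ i k j))

tail : Permutation′ (suc n) → Permutation′ n
tail = remove zero

module _ (π : Permutation′ (suc n)) where

  head : Fin (suc n)
  head = π ⟨$⟩ʳ zero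

  π-suc : ∀ j → π ⟨$⟩ʳ suc j ≡ punchIn head (tail π ⟨$⟩ʳ j)
  π-suc = punchIn-permute π zero

  tail-<-head : ∀ j → π ⟨$⟩ʳ suc j Fin.< head ⇔ toℕ (tail π ⟨$⟩ʳ j) < toℕ head
  tail-<-head j = subst (λ x → x Fin.< head ⇔ toℕ (tail π ⟨$⟩ʳ j) < toℕ head)
                    (sym (π-suc j)) (punchIn-<-pivot head _)

  tail-< : ∀ j k → π ⟨$⟩ʳ suc j Fin.< π ⟨$⟩ʳ suc k ⇔ tail π ⟨$⟩ʳ j Fin.< tail π ⟨$⟩ʳ k
  tail-< j k = subst₂ (λ x y → x Fin.< y ⇔ tail π ⟨$⟩ʳ j Fin.< tail π ⟨$⟩ʳ k)
                 (sym (π-suc j)) (sym (π-suc k)) (punchIn-< head _ _)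

  -- Inversions at position 0 correspond to the later values below the head; reindexing along the
  -- permutation `tail π` turns their number into the number of all j below the head. Relabelling
  -- the remaining values keeps their order, so the other inversions are those of the tail.
  inv-head-tail : inv π ≡ toℕ head + inv (tail π)
  inv-head-tail = begin
    inv π
      ≡⟨ inv≡∑∑ π ⟩
    (∑.sum λ j → 𝟙 ((zero {n} Fin.<? suc j) ×-dec (π ⟨$⟩ʳ suc j Fin.<? head)))
      + (∑.sum λ i → ∑.sum λ j → 𝟙 ((suc i Fin.<? suc j) ×-dec (π ⟨$⟩ʳ suc j Fin.<? π ⟨$⟩ʳ suc i)))
      ≡⟨ cong₂ _+_
           (∑.sum-cong-≗ λ j → 𝟙-⇔
             (mk⇔ (to (tail-<-head j) ∘ proj₂) (λ p → z<s , from (tail-<-head j) p))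
             ((zero {n} Fin.<? suc j) ×-dec (π ⟨$⟩ʳ suc j Fin.<? head))
             (toℕ (tail π ⟨$⟩ʳ j) <? toℕ head))
           (∑.sum-cong-≗ λ i → ∑.sum-cong-≗ λ j → 𝟙-⇔
             (mk⇔ (λ (p , q) → s<s⁻¹ p , to (tail-< j i) q)
                  (λ (p , q) → s<s p , from (tail-< j i) q))
             ((suc i Fin.<? suc j) ×-dec (π ⟨$⟩ʳ suc j Fin.<? π ⟨$⟩ʳ suc i))
             ((i Fin.<? j) ×-dec (tail π ⟨$⟩ʳ j Fin.<? tail π ⟨$⟩ʳ i))) ⟩
    (∑.sum λ j → 𝟙 (toℕ (tail π ⟨$⟩ʳ j) <? toℕ head)) + _
      ≡⟨ cong₂ _+_ (∑.sum-permute (λ j → 𝟙 (toℕ j <? toℕ head)) (tail π)) (inv≡∑∑ (tail π)) ⟨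
    (∑.sum λ (j : Fin n) → 𝟙 (toℕ j <? toℕ head)) + inv (tail π)
      ≡⟨ cong (_+ inv (tail π)) (∑-𝟙-< n (Fin.toℕ≤pred[n] head)) ⟩
    toℕ head + inv (tail π) ∎
    where open ≡-Reasoning

-- `tail` closes the gap that the head leaves among the values, so each head in turn is the number
-- of later smaller entries.
code : Permutation′ n → List ℕ
code {zero}  π = []
code {suc n} π = toℕ (head π) ∷ code (tail π)

length-code : (π : Permutation′ n) → length (code π) ≡ n
length-code {zero}  π = refl
length-code {suc n} π = cong suc (length-code (tail π))

inv≡sum-code : (π : Permutation′ n) → inv π ≡ sum (code π)
inv≡sum-code {zero}  π = refl
inv≡sum-code {suc n} π =
  trans (inv-head-tail π) (cong (λ s → toℕ (head π) + s) (inv≡sum-code (tail π)))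

code-cong : (π σ : Permutation′ n) → π ≈ σ → code π ≡ code σ
code-cong {zero}  π σ π≈σ = refl
code-cong {suc n} π σ π≈σ = cong₂ _∷_ (cong toℕ (π≈σ zero))
  (code-cong (tail π) (tail σ) λ j → Fin.punchIn-injective (head π) _ _ (begin
    punchIn (head π) (tail π ⟨$⟩ʳ j)  ≡⟨ π-suc π j ⟨
    π ⟨$⟩ʳ suc j                      ≡⟨ π≈σ (suc j) ⟩
    σ ⟨$⟩ʳ suc j                      ≡⟨ π-suc σ j ⟩
    punchIn (head σ) (tail σ ⟨$⟩ʳ j)  ≡⟨ cong (λ h → punchIn h (tail σ ⟨$⟩ʳ j)) (π≈σ zero) ⟨
    punchIn (head π) (tail σ ⟨$⟩ʳ j)  ∎))
  where open ≡-Reasoning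

code-injective : (π σ : Permutation′ n) → code π ≡ code σ → π ≈ σ
code-injective {suc n} π σ eq zero    = Fin.toℕ-injective (proj₁ (∷-injective eq))
code-injective {suc n} π σ eq (suc j) = begin
  π ⟨$⟩ʳ suc j                      ≡⟨ π-suc π j ⟩
  punchIn (head π) (tail π ⟨$⟩ʳ j)  ≡⟨ cong₂ punchIn (code-injective π σ eq zero)
                                         (code-injective (tail π) (tail σ) (proj₂ (∷-injective eq)) j) ⟩
  punchIn (head σ) (tail σ ⟨$⟩ʳ j)  ≡⟨ π-suc σ j ⟨
  σ ⟨$⟩ʳ suc j                      ∎
  where open ≡-Reasoning

-- Avoidance read off the code

Step : ℕ → List ℕ → Set
Step x []      = ⊤
Step x (y ∷ _) = y ≡ 0 ⊎ x ≤ y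

-- Codes of permutations avoiding 32-1: together with x ≤ length l, Step says that
-- a descent can only lead to an entry 0, that is, to a right-to-left minimum.
data Good : List ℕ → Set where
  []  : Good []
  _∷_ : ∀ {x l} → x ≤ length l × Step x l → Good l → Good (x ∷ l)

-- A nonzero code entry smaller than its predecessor would create the pattern: the first two values
-- descend, and the least value of the tail comes later still.
code-step : (π : Permutation′ (suc n)) → Avoids-32-1 π → Step (toℕ (head π)) (code (tail π))
code-step {zero}  π av = tt
code-step {suc n} π av with toℕ (head π) ≤? toℕ (head (tail π)) | toℕ (head (tail π)) ≟ 0
... | yes p | _     = inj₂ p
... | no _  | yes q = inj₁ q
... | no ¬p | no ¬q = contradiction
  (zero , suc zero , suc j , refl , s≤s (Fin.≤∧≢⇒< z≤n 0≢j)
  , from (tail-<-head π zero) (≰⇒> ¬p) , from (tail-< π j zero) πj<π0) av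
  where
  -- The position of the least value of the tail supplies the last entry of the pattern.
  j = tail π ⟨$⟩ˡ zero
  πj≡0 : tail π ⟨$⟩ʳ j ≡ zero
  πj≡0 = inverseʳ (tail π)
  πj<π0 : tail π ⟨$⟩ʳ j Fin.< head (tail π)
  πj<π0 = subst (Fin._< head (tail π)) (sym πj≡0) (n≢0⇒n>0 ¬q)
  0≢j : ¬ (zero ≡ j)
  0≢j 0≡j = ¬q (cong toℕ (trans (cong (tail π ⟨$⟩ʳ_) 0≡j) πj≡0))

tail-avoids : (π : Permutation′ (suc n)) → Avoids-32-1 π → Avoids-32-1 (tail π)
tail-avoids π av (i , i⁺ , j , eq , i⁺<j , p , q) = av
  (suc i , suc i⁺ , suc j , cong suc eq , s<s i⁺<j
  , from (tail-< π i⁺ i) p , from (tail-< π j i⁺) q)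

avoids⇒good : (π : Permutation′ n) → Avoids-32-1 π → Good (code π)
avoids⇒good {zero}  π av = []
avoids⇒good {suc n} π av =
  (subst (toℕ (head π) ≤_) (sym (length-code (tail π))) (Fin.toℕ≤pred[n] (head π))
  , code-step π av) ∷ avoids⇒good (tail π) (tail-avoids π av)

-- A pattern that starts later lies in the tail. One at the front would need a value below a tail
-- head with code 0, or a descent that x ≤ y excludes.
good⇒avoids : (π : Permutation′ n) → Good (code π) → Avoids-32-1 π
good⇒avoids {suc n} π (_ ∷ g) (suc i , suc i⁺ , suc j , eq , i⁺<j , p , q) =
  good⇒avoids (tail π) g
    (i , i⁺ , j , suc-injective eq , s<s⁻¹ i⁺<j , to (tail-< π i⁺ i) p , to (tail-< π j i⁺) q)
good⇒avoids {suc (suc n)} π ((_ , inj₁ y≡0) ∷ g) (zero , suc zero , suc j , eq , i⁺<j , p , q) =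
  n≮0 (subst (toℕ (tail π ⟨$⟩ʳ j) <_) y≡0 (to (tail-< π j zero) q))
good⇒avoids {suc (suc n)} π ((_ , inj₂ x≤y) ∷ g) (zero , suc zero , suc j , eq , i⁺<j , p , q) =
  <⇒≱ (to (tail-<-head π zero) p) x≤y

decode : ∀ {l} → Good l → ∃[ π ] code {length l} π ≡ l
decode [] = idₚ , refl
decode {x ∷ l} ((x≤ , _) ∷ g) with π , eq ← decode g =
  insert zero (fromℕ< (s≤s x≤)) π , cong₂ _∷_ (Fin.toℕ-fromℕ< (s≤s x≤))
    (trans (code-cong _ π (remove-insert zero (fromℕ< (s≤s x≤)) π)) eq)

-- Enumeration of a setoid by a list

lookup-injective : ∀ {A : Set} {xs : List A} → Unique xs →
  ∀ i j → List.lookup xs i ≡ List.lookup xs j → i ≡ j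
lookup-injective (x∉ ∷ u) zero    zero    eq = refl
lookup-injective (x∉ ∷ u) zero    (suc j) eq = contradiction eq (All.lookup x∉ (∈-lookup j))
lookup-injective (x∉ ∷ u) (suc i) zero    eq = contradiction (sym eq) (All.lookup x∉ (∈-lookup i))
lookup-injective (x∉ ∷ u) (suc i) (suc j) eq = cong suc (lookup-injective u i j eq)

module _ {A : Set} (S : Setoid 0ℓ 0ℓ) where

  open Setoid S using (Carrier) renaming (_≈_ to _∼_; refl to ∼-refl)

  -- The map `f` embeds the setoid into `A` with the entries of `xs` as image; in a list without
  -- repetitions, the position of `f s` is then a bijective label for s.
  enumerate : {xs : List A} → Unique xs →
    (f : Carrier → A) → (∀ {s t} → s ∼ t → f s ≡ f t) → (∀ {s t} → f s ≡ f t → s ∼ t) →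
    (∀ s → f s ∈ xs) → (∀ {x} → x ∈ xs → ∃[ s ] f s ≡ x) →
    HasCardinality S (length xs)
  enumerate {xs = xs} u f f-cong f-inj f∈ f⁻¹ = record
    { to        = ix
    ; from      = pt
    ; to-cong   = ix-cong ∘ f-cong
    ; from-cong = λ { refl → ∼-refl }
    ; inverse   = (λ {i} s∼ → lookup-injective u _ _
                     (trans (lookup-ix _) (trans (f-cong s∼) (f-pt i))))
                , λ { {s} refl → f-inj (trans (f-pt (ix s)) (lookup-ix s)) }
    }
    where
    ix : Carrier → Fin (length xs)
    ix s = index (f∈ s)
    lookup-ix : ∀ s → List.lookup xs (ix s) ≡ f s
    lookup-ix s = sym (lookup-index (f∈ s))
    pt : Fin (length xs) → Carrier
    pt i = proj₁ (f⁻¹ (∈-lookup i))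
    f-pt : ∀ i → f (pt i) ≡ List.lookup xs i
    f-pt i = proj₂ (f⁻¹ (∈-lookup i))
    ix-cong : ∀ {s t} → f s ≡ f t → ix s ≡ ix t
    ix-cong eq = lookup-injective u _ _ (trans (lookup-ix _) (trans eq (sym (lookup-ix _))))

-- Triangular and tetrahedral numbers

T-suc : ∀ i → T (suc i) ≡ T i + suc i
T-suc i = begin
  T (suc i)          ≡⟨ nCk+nC[k+1]≡[n+1]C[k+1] (suc i) 1 ⟨
  suc i C 1 + T i    ≡⟨ cong (_+ T i) (nC1≡n (suc i)) ⟩
  suc i + T i        ≡⟨ +-comm (suc i) (T i) ⟩
  T i + suc i        ∎
  where open ≡-Reasoning

2*T : ∀ i → 2 * T i ≡ i * suc i
2*T zero    = refl
2*T (suc i) = begin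
  2 * T (suc i)       ≡⟨ cong (2 *_) (T-suc i) ⟩
  2 * (T i + suc i)   ≡⟨ *-distribˡ-+ 2 (T i) (suc i) ⟩
  2 * T i + 2 * suc i ≡⟨ cong (_+ 2 * suc i) (2*T i) ⟩
  i * suc i + 2 * suc i ≡⟨ ring i ⟩
  suc i * suc (suc i) ∎
  where
  open ≡-Reasoning
  ring : ∀ i → i * suc i + 2 * suc i ≡ suc i * suc (suc i)
  ring = ℕ-Solver.solve-∀

∑T-suc : ∀ r → ∑T (suc r) ≡ ∑T r + T (suc r)
∑T-suc r = begin
  sum (applyUpTo t (suc r))    ≡⟨ cong sum (applyUpTo-∷ʳ t r) ⟨
  sum (applyUpTo t r ∷ʳ t r)   ≡⟨ sum-++ (applyUpTo t r) [ t r ] ⟩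
  ∑T r + (t r + 0)             ≡⟨ cong (λ t → ∑T r + t) (+-identityʳ (t r)) ⟩
  ∑T r + T (suc r)             ∎
  where
  open ≡-Reasoning
  t = λ i → T (suc i)

∑T≡C : ∀ r → ∑T r ≡ (r + 2) C 3
∑T≡C zero    = refl
∑T≡C (suc r) = begin
  ∑T (suc r)                     ≡⟨ ∑T-suc r ⟩
  ∑T r + T (suc r)               ≡⟨ cong₂ _+_ (∑T≡C r) (cong (_C 2) (+-comm 2 r)) ⟩
  (r + 2) C 3 + (r + 2) C 2      ≡⟨ +-comm ((r + 2) C 3) _ ⟩
  (r + 2) C 2 + (r + 2) C 3      ≡⟨ nCk+nC[k+1]≡[n+1]C[k+1] (r + 2) 2 ⟩
  (suc r + 2) C 3                ∎
  where open ≡-Reasoning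

-- Decomposition of codes into blocks

-- The repeated entry is the largest that a code allows just before this 0, so this is the heaviest
-- block of size p in front of l.
block : ℕ → List ℕ → List ℕ
block p l = replicate p (suc (length l)) ++ 0 ∷ l

length-block : ∀ p l → length (block p l) ≡ p + suc (length l)
length-block p l = go p
  where
  go : ∀ q → length (replicate q (suc (length l)) ++ 0 ∷ l) ≡ q + suc (length l)
  go zero    = refl
  go (suc q) = cong suc (go q)

sum-block : ∀ p l → sum (block p l) ≡ p * suc (length l) + sum l
sum-block zero    l = refl
sum-block (suc p) l = trans (cong (λ t → suc (length l) + t) (sum-block p l))
                        (sym (+-assoc (suc (length l)) _ _))

block-good : ∀ p {l} → Good l → Good (block p l)
block-good zero    {[]}    g = (z≤n , tt) ∷ g
block-good zero    {_ ∷ _} g = (z≤n , inj₂ z≤n) ∷ g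
block-good (suc p) {l}     g = (bounded , step p) ∷ block-good p g
  where
  bounded : suc (length l) ≤ length (block p l)
  bounded = subst (suc (length l) ≤_) (sym (length-block p l)) (m≤n+m _ p)
  step : ∀ q → Step (suc (length l)) (block q l)
  step zero    = inj₁ refl
  step (suc q) = inj₂ ≤-refl

-- The entries of the run are positive, so the first 0 determines where the run ends.
block-injective : ∀ p q {k l} → block p k ≡ block q l → p ≡ q × k ≡ l
block-injective p q = go p q
  where
  go : ∀ p q {x y k l} → replicate p (suc x) ++ 0 ∷ k ≡ replicate q (suc y) ++ 0 ∷ l →
       p ≡ q × k ≡ l
  go zero    zero    eq = refl , proj₂ (∷-injective eq)
  go (suc p) (suc q) eq with refl , k≡l ← go p q (proj₂ (∷-injective eq)) = refl , k≡l

-- `loss` measures how far the first block of l falls short of the heaviest block with the same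
-- `size` and `rest`.
record Split (l : List ℕ) : Set where
  field
    size  : ℕ
    rest  : List ℕ
    loss  : ℕ
    good  : Good rest
    length≡ : length l ≡ size + suc (length rest)
    sum≡    : sum l + loss ≡ size * suc (length rest) + sum rest
    exact   : loss ≡ 0 → l ≡ block size rest

open Split

split-zero : ∀ {l} → Good l → Split (0 ∷ l)
split-zero {l} g = record
  { size = 0; rest = l; loss = 0; good = g; length≡ = refl
  ; sum≡ = +-identityʳ (sum l); exact = λ _ → refl }

split-∷ : ∀ {x l} (s : Split l) → x ≤ suc (length (rest s)) → Split (x ∷ l)
split-∷ {x} {l} s x≤ = record
  { size = suc (size s) ; rest = rest s ; loss = d + loss s ; good = good s
  ; length≡ = cong suc (length≡ s)
  ; sum≡    = begin
      x + sum l + (d + loss s)    ≡⟨ shuffle x (sum l) d (loss s) ⟩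
      (x + d) + (sum l + loss s)  ≡⟨ cong₂ _+_ (m+[n∸m]≡n x≤) (sum≡ s) ⟩
      b + (size s * b + sum (rest s)) ≡⟨ +-assoc b _ _ ⟨
      suc (size s) * b + sum (rest s) ∎
  ; exact   = λ d+loss≡0 → cong₂ _∷_
      (≤-antisym x≤ (m∸n≡0⇒m≤n (m+n≡0⇒m≡0 d d+loss≡0)))
      (exact s (m+n≡0⇒n≡0 d d+loss≡0))
  }
  where
  open ≡-Reasoning
  b = suc (length (rest s))
  d = b ∸ x
  shuffle : ∀ x l d e → x + l + (d + e) ≡ (x + d) + (l + e)
  shuffle = ℕ-Solver.solve-∀

-- A nonzero entry is followed by 0 or by an entry at least as large. The entry just before the
-- first 0 is bounded through its position, and the second component carries this bound back along
-- the run.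
split : ∀ {x l} → Good (x ∷ l) → Σ[ s ∈ Split (x ∷ l) ] x ≤ suc (length (rest s))
split {zero}                ((_ , _) ∷ g) = split-zero g , z≤n
split {suc x} {.0 ∷ l} ((x≤ , inj₁ refl) ∷ (_ ∷ g)) = split-∷ (split-zero g) x≤ , x≤
split {suc x} {y ∷ l}  ((_ , inj₂ x≤y) ∷ g) with s , y≤ ← split g =
  split-∷ s x≤ , x≤
  where x≤ = ≤-trans x≤y y≤

-- The family of upper bounds

-- Twice the number U r N, as an integer because N may be less than r.
bound : ℕ → ℕ → ℤ
bound r N = let x = + N ℤ.- + r in x ℤ.* (x ℤ.- 1ℤ) ℤ.+ + (2 * ∑T r)

2*∑T-suc : ∀ r → + (2 * ∑T (suc r)) ≡ + (2 * ∑T r) ℤ.+ (1ℤ ℤ.+ + r) ℤ.* (+ 2 ℤ.+ + r)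
2*∑T-suc r = begin
  + (2 * ∑T (suc r))               ≡⟨ cong (λ t → + (2 * t)) (∑T-suc r) ⟩
  + (2 * (∑T r + T (suc r)))       ≡⟨ cong +_ (*-distribˡ-+ 2 (∑T r) (T (suc r))) ⟩
  + (2 * ∑T r + 2 * T (suc r))     ≡⟨ cong (λ t → + (2 * ∑T r + t)) (2*T (suc r)) ⟩
  + (2 * ∑T r) ℤ.+ + (suc r * suc (suc r))
    ≡⟨ cong (λ t → + (2 * ∑T r) ℤ.+ t) (ℤ.pos-* (suc r) (suc (suc r))) ⟩
  _ ∎
  where open ≡-Reasoning

-- The identity is doubled to avoid halves; k (k - 1) is the price of the block size p.
bound-block : ∀ r p b → let k = + p ℤ.- + suc r in
  bound (suc r) (p + suc b) ≡
  + (2 * (p * suc b)) ℤ.+ bound r b ℤ.+ k ℤ.* (k ℤ.- 1ℤ)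
bound-block r p b = begin
  bound (suc r) (p + suc b)
    ≡⟨ cong (λ t → x ℤ.* (x ℤ.- 1ℤ) ℤ.+ t) (2*∑T-suc r) ⟩
  _ ≡⟨ ring (+ p) (+ r) (+ b) (+ (2 * ∑T r)) ⟩
  + 2 ℤ.* (+ p ℤ.* (1ℤ ℤ.+ + b)) ℤ.+ bound r b ℤ.+ k ℤ.* (k ℤ.- 1ℤ)
    ≡⟨ cong (λ t → t ℤ.+ bound r b ℤ.+ k ℤ.* (k ℤ.- 1ℤ))
         (trans (ℤ.pos-* 2 (p * suc b)) (cong (+ 2 ℤ.*_) (ℤ.pos-* p (suc b)))) ⟨
  _ ∎
  where
  open ≡-Reasoning
  x = + (p + suc b) ℤ.- + suc r
  k = + p ℤ.- + suc r
  ring : ∀ P R B S →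
    ((P ℤ.+ (1ℤ ℤ.+ B)) ℤ.- (1ℤ ℤ.+ R)) ℤ.* (((P ℤ.+ (1ℤ ℤ.+ B)) ℤ.- (1ℤ ℤ.+ R)) ℤ.- 1ℤ)
      ℤ.+ (S ℤ.+ (1ℤ ℤ.+ R) ℤ.* (+ 2 ℤ.+ R))
    ≡ + 2 ℤ.* (P ℤ.* (1ℤ ℤ.+ B)) ℤ.+ ((B ℤ.- R) ℤ.* ((B ℤ.- R) ℤ.- 1ℤ) ℤ.+ S)
      ℤ.+ (P ℤ.- (1ℤ ℤ.+ R)) ℤ.* ((P ℤ.- (1ℤ ℤ.+ R)) ℤ.- 1ℤ)
  ring = ℤ-Solver.solve-∀

-- Two consecutive integers never have opposite signs. The vanishing cases k = 0 and k = 1 are the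
-- source of the two optimal block sizes.
pronic : ∀ k → ∃[ e ] + e ≡ k ℤ.* (k ℤ.- 1ℤ) × (e ≡ 0 → k ≡ 0ℤ ⊎ k ≡ 1ℤ)
pronic (+ zero)  = 0 , refl , λ _ → inj₁ refl
pronic (+ suc m) = suc m * m , ℤ.pos-* (suc m) m ,
  λ e≡0 → inj₂ (cong (λ i → + suc i) (m+n≡0⇒m≡0 m e≡0))
-- The summand 0 is what the integer subtraction of 1 leaves, so that the equation holds by
-- computation.
pronic -[1+ m ]  = suc m * suc (suc (m + 0)) , refl , λ ()

-- The codes attaining bound r; their length N satisfies N + 1 = T (r + 1) + j,
-- so j is the λₙ of the theorem when r = ρ n.  The redundant range j ≤ r + 2
-- instead of j ≤ r + 1 makes the recursion uniform.
optima : ℕ → ℕ → List (List ℕ)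
optima zero    0       = [ [] ]
optima zero    1       = [ 0 ∷ [] ]
optima zero    2       = [ 1 ∷ 0 ∷ [] ]
optima zero    _       = []
optima (suc r) zero    = map (block (suc r)) (optima r zero)
optima (suc r) (suc j) = map (block (suc r)) (optima r (suc j))
                      ++ map (block (suc (suc r))) (optima r j)

-- Properties of the optimal codes

record Optimal (r j : ℕ) (l : List ℕ) : Set where
  field
    is-good : Good l
    suc-length≡ : suc (length l) ≡ T (suc r) + j
    2*sum≡    : + (2 * sum l) ≡ bound r (length l)

-- Once k (k - 1) vanishes, `bound-block` carries equality from l to the longer code. The block adds
-- δ + r + 2 entries, and r + 2 is the step from T (r + 1) to T (r + 2), so j grows by δ.
block-optimal : ∀ r j {p l} (δ : ℕ) → p ≡ δ + suc r →
  (let k = + p ℤ.- + suc r in k ℤ.* (k ℤ.- 1ℤ) ≡ 0ℤ) →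
  Optimal r j l → Optimal (suc r) (δ + j) (block p l)
block-optimal r j {p} {l} δ p≡ k≡0 o = record
  { is-good = block-good p is-good
  ; suc-length≡ = begin
      suc (length (block p l))    ≡⟨ cong suc (length-block p l) ⟩
      suc (p + suc (length l))    ≡⟨ cong₂ (λ u v → suc (u + v)) p≡ suc-length≡ ⟩
      suc (δ + suc r + (T (suc r) + j)) ≡⟨ ring δ r (T (suc r)) j ⟩
      T (suc r) + suc (suc r) + (δ + j) ≡⟨ cong (_+ (δ + j)) (T-suc (suc r)) ⟨
      T (suc (suc r)) + (δ + j)   ∎
  ; 2*sum≡ = begin
      + (2 * sum (block p l))
        ≡⟨ cong (λ s → + (2 * s)) (sum-block p l) ⟩
      + (2 * (p * suc (length l) + sum l))
        ≡⟨ cong +_ (*-distribˡ-+ 2 (p * suc (length l)) (sum l)) ⟩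
      + (2 * (p * suc (length l))) ℤ.+ + (2 * sum l)
        ≡⟨ cong (λ t → + (2 * (p * suc (length l))) ℤ.+ t) 2*sum≡ ⟩
      + (2 * (p * suc (length l))) ℤ.+ bound r (length l)
        ≡⟨ ℤ.+-identityʳ _ ⟨
      + (2 * (p * suc (length l))) ℤ.+ bound r (length l) ℤ.+ 0ℤ
        ≡⟨ cong (λ t → + (2 * (p * suc (length l))) ℤ.+ bound r (length l) ℤ.+ t) k≡0 ⟨
      _ ≡⟨ bound-block r p (length l) ⟨
      bound (suc r) (p + suc (length l))
        ≡⟨ cong (bound (suc r)) (length-block p l) ⟨
      bound (suc r) (length (block p l)) ∎
  }
  where
  open Optimal o
  open ≡-Reasoning
  ring : ∀ δ r t j → suc (δ + suc r + (t + j)) ≡ t + suc (suc r) + (δ + j)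
  ring = ℕ-Solver.solve-∀

block-optimal₀ : ∀ r j {l} → Optimal r j l → Optimal (suc r) j (block (suc r) l)
block-optimal₀ r j = block-optimal r j 0 refl
  (cong (λ k → k ℤ.* (k ℤ.- 1ℤ)) (ℤ.+-inverseʳ (+ suc r)))

block-optimal₁ : ∀ r j {l} → Optimal r j l → Optimal (suc r) (suc j) (block (suc (suc r)) l)
block-optimal₁ r j = block-optimal r j 1 refl
  (cong (λ k → k ℤ.* (k ℤ.- 1ℤ)) (k≡1 (+ suc r)))
  where
  k≡1 : ∀ R → (1ℤ ℤ.+ R) ℤ.- R ≡ 1ℤ
  k≡1 = ℤ-Solver.solve-∀

∈optima⇒optimal : ∀ r j {l} → l ∈ optima r j → Optimal r j l
∈optima⇒optimal zero 0 (here refl) = record { is-good = [] ; suc-length≡ = refl ; 2*sum≡ = refl }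
∈optima⇒optimal zero 1 (here refl) =
  record { is-good = block-good 0 [] ; suc-length≡ = refl ; 2*sum≡ = refl }
∈optima⇒optimal zero 2 (here refl) =
  record { is-good = block-good 1 [] ; suc-length≡ = refl ; 2*sum≡ = refl }
∈optima⇒optimal (suc r) zero l∈ with _ , k∈ , refl ← ∈-map⁻ (block (suc r)) l∈ =
  block-optimal₀ r 0 (∈optima⇒optimal r 0 k∈)
∈optima⇒optimal (suc r) (suc j) l∈ with ∈-++⁻ (map (block (suc r)) (optima r (suc j))) l∈
... | inj₁ l∈ˡ with _ , k∈ , refl ← ∈-map⁻ (block (suc r)) l∈ˡ =
  block-optimal₀ r (suc j) (∈optima⇒optimal r (suc j) k∈)
... | inj₂ l∈ʳ with _ , k∈ , refl ← ∈-map⁻ (block (suc (suc r))) l∈ʳ =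
  block-optimal₁ r j (∈optima⇒optimal r j k∈)

∈-block₀ : ∀ r j {l} → l ∈ optima r j → block (suc r) l ∈ optima (suc r) j
∈-block₀ r zero    l∈ = ∈-map⁺ (block (suc r)) l∈
∈-block₀ r (suc j) l∈ = ∈-++⁺ˡ (∈-map⁺ (block (suc r)) l∈)

∈-block₁ : ∀ r j {l} → l ∈ optima r j → block (suc (suc r)) l ∈ optima (suc r) (suc j)
∈-block₁ r j l∈ = ∈-++⁺ʳ (map (block (suc r)) (optima r (suc j))) (∈-map⁺ (block (suc (suc r))) l∈)

optima-unique : ∀ r j → Unique (optima r j)
optima-unique zero 0 = [] ∷ []
optima-unique zero 1 = [] ∷ []
optima-unique zero 2 = [] ∷ []
optima-unique zero (suc (suc (suc _))) = []
optima-unique (suc r) zero =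
  Unique.map⁺ (proj₂ ∘ block-injective (suc r) (suc r)) (optima-unique r zero)
optima-unique (suc r) (suc j) = Unique.++⁺
  (Unique.map⁺ (proj₂ ∘ block-injective (suc r) (suc r)) (optima-unique r (suc j)))
  (Unique.map⁺ (proj₂ ∘ block-injective (suc (suc r)) (suc (suc r))) (optima-unique r j))
  λ (∈ˡ , ∈ʳ) → let (_ , _ , eqˡ) = ∈-map⁻ (block (suc r)) ∈ˡ
                    (_ , _ , eqʳ) = ∈-map⁻ (block (suc (suc r))) ∈ʳ
                in m≢1+m+n (suc r) {0} (trans
                     (proj₁ (block-injective (suc r) (suc (suc r)) (trans (sym eqˡ) eqʳ)))
                     (cong (λ i → suc (suc i)) (sym (+-identityʳ r))))

-- Each of the r blocks adds 0 or 1 to j and the base adds 0, 1 or 2, which reaches everything from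
-- 0 to r + 2.
optima-nonempty : ∀ r {j} → j ≤ 2 + r → ∃[ l ] l ∈ optima r j
optima-nonempty zero {0} _ = _ , here refl
optima-nonempty zero {1} _ = _ , here refl
optima-nonempty zero {2} _ = _ , here refl
optima-nonempty zero {suc (suc (suc _))} (s≤s (s≤s ()))
optima-nonempty (suc r) {zero}  _         = let l , l∈ = optima-nonempty r z≤n in _ , ∈-block₀ r 0 l∈
optima-nonempty (suc r) {suc j} (s≤s j≤) = let l , l∈ = optima-nonempty r j≤ in _ , ∈-block₁ r j l∈

-- Counting the optimal codes

nC0≡1 : ∀ n → n C 0 ≡ 1
nC0≡1 n = trans (nCk≡nC[n∸k] {0} {n} z≤n) (nCn≡1 n)

length-optima-zero : ∀ r → length (optima r 0) ≡ 1
length-optima-zero zero    = refl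
length-optima-zero (suc r) = trans (length-map (block (suc r)) (optima r 0)) (length-optima-zero r)

-- The two choices of block size give the count Pascal's recurrence, which both binomials on the
-- right also satisfy.
length-optima-suc : ∀ r j → length (optima r (suc j)) ≡ r C suc j + suc r C j
length-optima-suc zero 0 = refl
length-optima-suc zero 1 = refl
length-optima-suc zero (suc (suc j)) = sym (cong₂ _+_
  (k>n⇒nCk≡0 {0} {3 + j} z<s) (k>n⇒nCk≡0 {1} {2 + j} (s<s z<s)))
length-optima-suc (suc r) j = begin
  length (map (block (suc r)) (optima r (suc j)) ++ map (block (suc (suc r))) (optima r j))
    ≡⟨ length-++ (map (block (suc r)) (optima r (suc j))) ⟩
  length (map (block (suc r)) (optima r (suc j))) + length (map (block (suc (suc r))) (optima r j))
    ≡⟨ cong₂ _+_ (length-map (block (suc r)) (optima r (suc j)))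
                 (length-map (block (suc (suc r))) (optima r j)) ⟩
  length (optima r (suc j)) + length (optima r j)
    ≡⟨ cong (_+ length (optima r j)) (length-optima-suc r j) ⟩
  r C suc j + suc r C j + length (optima r j)
    ≡⟨ pascal j ⟩
  suc r C suc j + suc (suc r) C j ∎
  where
  open ≡-Reasoning
  interchange : ∀ a b c d → a + b + (c + d) ≡ (c + a) + (d + b)
  interchange = ℕ-Solver.solve-∀
  pascal : ∀ j → r C suc j + suc r C j + length (optima r j) ≡ suc r C suc j + suc (suc r) C j
  -- The second binomial for `optima r 0` would have lower index -1. Its length 1 is absorbed as a
  -- binomial with lower index 0 instead.
  pascal zero = begin
    r C 1 + suc r C 0 + length (optima r 0)
      ≡⟨ cong₂ (λ u v → r C 1 + u + v) (nC0≡1 (suc r)) (length-optima-zero r) ⟩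
    r C 1 + 1 + 1
      ≡⟨ cong (_+ 1) (+-comm (r C 1) 1) ⟩
    1 + r C 1 + 1
      ≡⟨ cong₂ (λ u v → u + r C 1 + v) (nC0≡1 r) (nC0≡1 (suc (suc r))) ⟨
    r C 0 + r C 1 + suc (suc r) C 0
      ≡⟨ cong (_+ suc (suc r) C 0) (nCk+nC[k+1]≡[n+1]C[k+1] r 0) ⟩
    suc r C 1 + suc (suc r) C 0 ∎
  pascal (suc j) = begin
    r C (2 + j) + suc r C suc j + length (optima r (suc j))
      ≡⟨ cong (λ t → r C (2 + j) + suc r C suc j + t) (length-optima-suc r j) ⟩
    r C (2 + j) + suc r C suc j + (r C suc j + suc r C j)
      ≡⟨ interchange (r C (2 + j)) (suc r C suc j) (r C suc j) (suc r C j) ⟩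
    (r C suc j + r C (2 + j)) + (suc r C j + suc r C suc j)
      ≡⟨ cong₂ _+_ (nCk+nC[k+1]≡[n+1]C[k+1] r (suc j)) (nCk+nC[k+1]≡[n+1]C[k+1] (suc r) j) ⟩
    suc r C (2 + j) + suc (suc r) C suc j ∎

length-optima : ∀ r j → length (optima r j) ≡ binom r (+ j) + binom (suc r) (+ j ℤ.- 1ℤ)
length-optima r zero    = trans (length-optima-zero r) (sym (trans (+-identityʳ _) (nC0≡1 r)))
length-optima r (suc j) = length-optima-suc r j

-- Upper bounds with their equality cases

-- For r = 0 the bound adds up the largest possible value of every entry, and e is twice the total
-- shortfall. Equality forces the staircase N - 1, ..., 1, 0, which `Step` rules out for N ≥ 3.
sum-bound-zero : ∀ {l} → Good l →
  ∃[ e ] + (2 * sum l + e) ≡ bound 0 (length l) × (e ≡ 0 → ∃[ j ] l ∈ optima 0 j)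
sum-bound-zero [] = 0 , refl , λ _ → 0 , here refl
sum-bound-zero {x ∷ l} ((x≤ , step) ∷ g) with e , eq , opt ← sum-bound-zero g =
  d + d + e , eq′ , opt′
  where
  open ≡-Reasoning
  d = length l ∸ x
  x+d≡ : x + d ≡ length l
  x+d≡ = m+[n∸m]≡n x≤
  shuffle : ∀ x s d e → 2 * (x + s) + (d + d + e) ≡ 2 * (x + d) + (2 * s + e)
  shuffle = ℕ-Solver.solve-∀
  ring : ∀ N → + 2 ℤ.* N ℤ.+ ((N ℤ.- 0ℤ) ℤ.* ((N ℤ.- 0ℤ) ℤ.- 1ℤ) ℤ.+ 0ℤ)
       ≡ ((1ℤ ℤ.+ N) ℤ.- 0ℤ) ℤ.* (((1ℤ ℤ.+ N) ℤ.- 0ℤ) ℤ.- 1ℤ) ℤ.+ 0ℤ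
  ring = ℤ-Solver.solve-∀
  eq′ : + (2 * (x + sum l) + (d + d + e)) ≡ bound 0 (suc (length l))
  eq′ = begin
    + (2 * (x + sum l) + (d + d + e))      ≡⟨ cong +_ (shuffle x (sum l) d e) ⟩
    + (2 * (x + d)) ℤ.+ + (2 * sum l + e)  ≡⟨ cong₂ (λ u v → + (2 * u) ℤ.+ v) x+d≡ eq ⟩
    + (2 * length l) ℤ.+ bound 0 (length l) ≡⟨ cong (ℤ._+ bound 0 (length l)) (ℤ.pos-* 2 (length l)) ⟩
    _                                      ≡⟨ ring (+ length l) ⟩
    bound 0 (suc (length l))               ∎
  extend : ∀ {x l} j → x ≡ length l → Step x l → l ∈ optima 0 j → ∃[ j ] x ∷ l ∈ optima 0 j
  extend 0 refl _         (here refl) = 1 , here refl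
  extend 1 refl _         (here refl) = 2 , here refl
  -- The code 2, 1, 0 descends to a nonzero entry.
  extend 2 refl (inj₁ ()) (here refl)
  extend 2 refl (inj₂ (s≤s ())) (here refl)
  opt′ : d + d + e ≡ 0 → ∃[ j ] x ∷ l ∈ optima 0 j
  opt′ e≡0 = extend (proj₁ l∈)
    (trans (sym (+-identityʳ x)) (trans (cong (λ t → x + t) (sym d≡0)) x+d≡)) step (proj₂ l∈)
    where
    d≡0 : d ≡ 0
    d≡0 = m+n≡0⇒m≡0 d (m+n≡0⇒m≡0 (d + d) e≡0)
    l∈ = opt (m+n≡0⇒n≡0 (d + d) e≡0)

-- The inequality is stated through its doubled deficit e, so that the induction carries the
-- equality case along. Removing the first block writes e as a sum of three natural numbers: the
-- loss of that block, the deficit of the rest at r, and k (k - 1). If e is 0, all three vanish.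
sum-bound : ∀ r {l} → Good l →
  ∃[ e ] + (2 * sum l + e) ≡ bound r (length l) × (e ≡ 0 → ∃[ j ] l ∈ optima r j)
sum-bound zero g = sum-bound-zero g
-- The bound at length 0 is strictly positive, so the empty code never attains it.
sum-bound (suc r) [] = suc r * suc (suc r) + 2 * ∑T (suc r) , eq , λ ()
  where
  ring : ∀ R S → (1ℤ ℤ.+ R) ℤ.* (+ 2 ℤ.+ R) ℤ.+ S
       ≡ (0ℤ ℤ.- (1ℤ ℤ.+ R)) ℤ.* ((0ℤ ℤ.- (1ℤ ℤ.+ R)) ℤ.- 1ℤ) ℤ.+ S
  ring = ℤ-Solver.solve-∀
  eq : + (suc r * suc (suc r) + 2 * ∑T (suc r)) ≡ bound (suc r) 0
  eq = trans (cong (ℤ._+ + (2 * ∑T (suc r))) (ℤ.pos-* (suc r) (suc (suc r))))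
             (ring (+ r) (+ (2 * ∑T (suc r))))
sum-bound (suc r) {x ∷ l} g@(_ ∷ _)
  with s , _ ← split g
  with e₁ , eq₁ , opt₁ ← sum-bound r (good s)
  with e₂ , eq₂ , k∈ ← pronic (+ size s ℤ.- + suc r)
  = 2 * loss s + e₁ + e₂ , eq , opt
  where
  open ≡-Reasoning
  p = size s
  b = length (rest s)
  k = + p ℤ.- + suc r
  shuffle : ∀ s e₀ e₁ e₂ → 2 * s + (2 * e₀ + e₁ + e₂) ≡ 2 * (s + e₀) + e₁ + e₂
  shuffle = ℕ-Solver.solve-∀
  expand : ∀ u v e₁ e₂ → 2 * (u + v) + e₁ + e₂ ≡ 2 * u + (2 * v + e₁) + e₂
  expand = ℕ-Solver.solve-∀
  eq : + (2 * sum (x ∷ l) + (2 * loss s + e₁ + e₂)) ≡ bound (suc r) (length (x ∷ l))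
  eq = begin
    + (2 * sum (x ∷ l) + (2 * loss s + e₁ + e₂))
      ≡⟨ cong +_ (shuffle (sum (x ∷ l)) (loss s) e₁ e₂) ⟩
    + (2 * (sum (x ∷ l) + loss s) + e₁ + e₂)
      ≡⟨ cong (λ t → + (2 * t + e₁ + e₂)) (sum≡ s) ⟩
    + (2 * (p * suc b + sum (rest s)) + e₁ + e₂)
      ≡⟨ cong +_ (expand (p * suc b) (sum (rest s)) e₁ e₂) ⟩
    + (2 * (p * suc b)) ℤ.+ + (2 * sum (rest s) + e₁) ℤ.+ + e₂
      ≡⟨ cong₂ (λ u v → + (2 * (p * suc b)) ℤ.+ u ℤ.+ v) eq₁ eq₂ ⟩
    + (2 * (p * suc b)) ℤ.+ bound r b ℤ.+ k ℤ.* (k ℤ.- 1ℤ)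
      ≡⟨ bound-block r p b ⟨
    bound (suc r) (p + suc b)
      ≡⟨ cong (bound (suc r)) (length≡ s) ⟨
    bound (suc r) (length (x ∷ l)) ∎
  cancel : ∀ P R → (P ℤ.- R) ℤ.+ R ≡ P
  cancel = ℤ-Solver.solve-∀
  p≡ : ∀ {δ} → k ≡ + δ → p ≡ δ + suc r
  p≡ k≡δ = ℤ.+-injective (trans (sym (cancel (+ p) (+ suc r))) (cong (ℤ._+ + suc r) k≡δ))
  opt : 2 * loss s + e₁ + e₂ ≡ 0 → ∃[ j ] x ∷ l ∈ optima (suc r) j
  opt e≡0 with j , rest∈ ← opt₁ (m+n≡0⇒n≡0 (2 * loss s) (m+n≡0⇒m≡0 _ e≡0))
             | l≡ ← exact s (m+n≡0⇒m≡0 (loss s) (m+n≡0⇒m≡0 (2 * loss s) (m+n≡0⇒m≡0 _ e≡0)))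
             | k∈ (m+n≡0⇒n≡0 (2 * loss s + e₁) e≡0)
  ... | inj₁ k≡0 = j , subst (_∈ optima (suc r) j)
    (sym (trans l≡ (cong (λ q → block q (rest s)) (p≡ k≡0)))) (∈-block₀ r j rest∈)
  ... | inj₂ k≡1 = suc j , subst (_∈ optima (suc r) (suc j))
    (sym (trans l≡ (cong (λ q → block q (rest s)) (p≡ k≡1)))) (∈-block₁ r j rest∈)

-- The choice r = ρ

8*T+1 : ∀ r → 8 * T (suc r) + 1 ≡ (3 + 2 * r) * (3 + 2 * r)
8*T+1 r = begin
  8 * T (suc r) + 1               ≡⟨ cong (_+ 1) (*-assoc 4 2 (T (suc r))) ⟩
  4 * (2 * T (suc r)) + 1         ≡⟨ cong (λ t → 4 * t + 1) (2*T (suc r)) ⟩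
  4 * (suc r * suc (suc r)) + 1   ≡⟨ ring r ⟩
  (3 + 2 * r) * (3 + 2 * r)       ∎
  where
  open ≡-Reasoning
  ring : ∀ r → 4 * (suc r * suc (suc r)) + 1 ≡ (3 + 2 * r) * (3 + 2 * r)
  ring = ℕ-Solver.solve-∀

8*n+17 : ∀ n → 8 * n + 17 ≡ 8 * (n + 2) + 1
8*n+17 = ℕ-Solver.solve-∀

-- As 8 T (ρ + 1) + 1 is the square of 2 ρ + 3 and 8 n + 17 = 8 (n + 2) + 1, the root-free bounds on
-- `ρ` place n + 2 between consecutive triangular numbers.
T[1+ρ]≤n+2 : ∀ n → T (suc (ρ n)) ≤ n + 2
T[1+ρ]≤n+2 n = *-cancelˡ-≤ 8 (+-cancelʳ-≤ 1 _ _
  (subst₂ _≤_ (sym (8*T+1 (ρ n))) (8*n+17 n) (ρ-lower n)))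

n+2<T[2+ρ] : ∀ n → n + 2 < T (suc (suc (ρ n)))
n+2<T[2+ρ] n = *-cancelˡ-< 8 _ _ (+-cancelʳ-< 1 _ _
  (subst₂ _<_ (8*n+17 n) (sym (8*T+1 (suc (ρ n)))) (ρ-upper n)))

-- With N = n + 1 and d = n - r, the product (N - r)(N - r - 1) is (d + 1) d = 2 T d; r ≤ n makes
-- the truncated subtraction exact.
bound≡2*maxinv : ∀ r n → r ≤ n → + (2 * (T (n ∸ r) + ∑T r)) ≡ bound r (suc n)
bound≡2*maxinv r n r≤n = begin
  + (2 * (T d + ∑T r))              ≡⟨ cong +_ (*-distribˡ-+ 2 (T d) (∑T r)) ⟩
  + (2 * T d) ℤ.+ S                 ≡⟨ cong (λ t → + t ℤ.+ S) (2*T d) ⟩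
  + (d * suc d) ℤ.+ S               ≡⟨ cong (ℤ._+ S) (ℤ.pos-* d (suc d)) ⟩
  + d ℤ.* (1ℤ ℤ.+ + d) ℤ.+ S        ≡⟨ ring (+ d) (+ r) S ⟩
  bound r (suc (d + r))             ≡⟨ cong (λ m → bound r (suc m)) (m∸n+n≡m r≤n) ⟩
  bound r (suc n)                   ∎
  where
  open ≡-Reasoning
  d = n ∸ r
  S = + (2 * ∑T r)
  ring : ∀ D R S → D ℤ.* (1ℤ ℤ.+ D) ℤ.+ S
    ≡ ((1ℤ ℤ.+ (D ℤ.+ R)) ℤ.- R) ℤ.* (((1ℤ ℤ.+ (D ℤ.+ R)) ℤ.- R) ℤ.- 1ℤ) ℤ.+ S
  ring = ℤ-Solver.solve-∀

-- The maximum and its attainment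

IsMaxinv-unique : ∀ {N m m′} → IsMaxinv N m → IsMaxinv N m′ → m ≡ m′
IsMaxinv-unique ((π , av , refl) , max) ((π′ , av′ , refl) , max′) =
  ≤-antisym (max′ π av) (max π′ av′)

-- `M` is the upper bound for length N, and the range of j provides an optimal code of that length,
-- so `M` is the maximum.
module _ {N M r j} (suc-N≡ : suc N ≡ T (suc r) + j) (j≤ : j ≤ 2 + r)
         (2*M≡ : + (2 * M) ≡ bound r N) where

  inv-bound : (π : Permutation′ N) → Avoids-32-1 π →
    ∃[ e ] 2 * inv π + e ≡ 2 * M × (e ≡ 0 → code π ∈ optima r j)
  inv-bound π av with e , eq , opt ← sum-bound r (avoids⇒good π av) = e , eq′ , opt′
    where
    eq′ : 2 * inv π + e ≡ 2 * M
    eq′ = trans (cong (λ s → 2 * s + e) (inv≡sum-code π))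
      (ℤ.+-injective (trans eq (trans (cong (bound r) (length-code π)) (sym 2*M≡))))
    opt′ : e ≡ 0 → code π ∈ optima r j
    -- The equality case yields some index i; the length of the code identifies it with j.
    opt′ e≡0 with i , c∈ ← opt e≡0 = subst (λ i → code π ∈ optima r i)
      (+-cancelˡ-≡ (T (suc r)) i j (begin
        T (suc r) + i            ≡⟨ Optimal.suc-length≡ (∈optima⇒optimal r i c∈) ⟨
        suc (length (code π))    ≡⟨ cong suc (length-code π) ⟩
        suc N                    ≡⟨ suc-N≡ ⟩
        T (suc r) + j            ∎)) c∈
      where open ≡-Reasoning

  inv≤ : (π : Permutation′ N) → Avoids-32-1 π → inv π ≤ M
  inv≤ π av with e , eq , _ ← inv-bound π av =
    *-cancelˡ-≤ 2 (subst (2 * inv π ≤_) eq (m≤m+n (2 * inv π) e))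

  code∈optima : (π : Permutation′ N) → Avoids-32-1 π → inv π ≡ M → code π ∈ optima r j
  code∈optima π av refl with e , eq , opt ← inv-bound π av =
    opt (m+n≡m⇒n≡0 (2 * inv π) eq)
    where
    m+n≡m⇒n≡0 : ∀ m {n} → m + n ≡ m → n ≡ 0
    m+n≡m⇒n≡0 m {n} eq = +-cancelˡ-≡ m n 0 (trans eq (sym (+-identityʳ m)))

  realize : ∀ {l} → l ∈ optima r j →
    ∃[ π ] Avoids-32-1 {N} π × inv π ≡ M × code π ≡ l
  realize {l} l∈ = go (suc-injective (trans suc-length≡ (sym suc-N≡)))
    where
    open Optimal (∈optima⇒optimal r j l∈)
    go : length l ≡ N → ∃[ π ] Avoids-32-1 {N} π × inv π ≡ M × code π ≡ l
    go refl with π , code≡ ← decode is-good =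
      π , good⇒avoids π (subst Good (sym code≡) is-good)
        , *-cancelˡ-≡ (inv π) M 2 (trans
            (cong (2 *_) (trans (inv≡sum-code π) (cong sum code≡)))
            (ℤ.+-injective (trans 2*sum≡ (sym 2*M≡))))
        , code≡

  isMaxinv : IsMaxinv N M
  isMaxinv with _ , l∈ ← optima-nonempty r j≤ with π , av , inv≡ , _ ← realize l∈ =
    (π , av , inv≡) , inv≤

  𝒵-cardinality : HasCardinality (𝒵 N) (length (optima r j))
  𝒵-cardinality = enumerate (𝒵 N) (optima-unique r j) (code ∘ proj₁)
    (λ {z} {w} → code-cong (proj₁ z) (proj₁ w))
    (λ {z} {w} → code-injective (proj₁ z) (proj₁ w))
    (λ (π , av , max) → code∈optima π av (IsMaxinv-unique max isMaxinv))
    λ l∈ → let (π , av , inv≡M , code≡) = realize l∈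
           in (π , av , subst (IsMaxinv N) (sym inv≡M) isMaxinv) , code≡

theorem1p3 : (n : ℕ) → 1 ≤ n →
    HasCardinality (𝒵 (suc n))
    (binom (ρ n) (λₙ n) + binom (suc (ρ n)) (λₙ n ℤ.- 1ℤ))
    × IsMaxinv (suc n) (T (n ∸ ρ n) + ∑T (ρ n))
    × T (n ∸ ρ n) + ∑T (ρ n) ≡ suc (n ∸ ρ n) C 2 + (ρ n + 2) C 3
theorem1p3 n _ =
    subst (HasCardinality (𝒵 (suc n))) count (𝒵-cardinality {M = M} {r} size≡ j≤ 2*M≡)
  , isMaxinv {M = M} {r} size≡ j≤ 2*M≡
  , cong (λ t → T (n ∸ ρ n) + t) (∑T≡C (ρ n))
  where
  r = ρ n
  M = T (n ∸ r) + ∑T r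
  j = n + 2 ∸ T (suc r)
  n+2≡ : n + 2 ≡ T (suc r) + j
  n+2≡ = sym (m+[n∸m]≡n (T[1+ρ]≤n+2 n))
  size≡ : suc (suc n) ≡ T (suc r) + j
  size≡ = trans (+-comm 2 n) n+2≡
  -- T (r + 2) exceeds T (r + 1) by r + 2, so n + 2 < T (r + 2) says j < r + 2.
  j≤ : j ≤ 2 + r
  j≤ = <⇒≤ (+-cancelˡ-< (T (suc r)) j (2 + r)
    (subst₂ _<_ n+2≡ (T-suc (suc r)) (n+2<T[2+ρ] n)))
  2*M≡ : + (2 * M) ≡ bound r (suc n)
  2*M≡ = bound≡2*maxinv r n (ρ≤n n)
  λₙ≡j : λₙ n ≡ + j
  λₙ≡j = begin
    + (n + 2) ℤ.- + T (suc r)           ≡⟨ cong (λ m → + m ℤ.- + T (suc r)) n+2≡ ⟩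
    + (T (suc r) + j) ℤ.- + T (suc r)   ≡⟨ cancel (+ T (suc r)) (+ j) ⟩
    + j                                 ∎
    where
    open ≡-Reasoning
    cancel : ∀ t i → (t ℤ.+ i) ℤ.- t ≡ i
    cancel = ℤ-Solver.solve-∀
  count : length (optima r j) ≡ binom r (λₙ n) + binom (suc r) (λₙ n ℤ.- 1ℤ)
  count = trans (length-optima r j)
    (cong (λ i → binom r i + binom (suc r) (i ℤ.- 1ℤ)) (sym λₙ≡j))
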